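{- Let $G$ be a connected undirected graph on $N\ge 2$ nodes with positive link weights, and let $\mathcal{S}$ and $\mathcal{S}^{+}$ be its original and inverse simplices in $\mathbb{R}^{N-1}$. Let $\mathcal{V}$ be a non-empty proper subset of $\mathcal{N}=\{1,\dots,N\}$ with $V$ elements. If $a_{\mathcal{V}}$ is an altitude of $\mathcal{S}$ from the face $\mathcal{F}_{\mathcal{V}}$ to the complementary face $\mathcal{F}_{\bar{\mathcal{V}}}$, then $$\frac{a_{\mathcal{V}}}{\Vert a_{\mathcal{V}}\Vert}=\frac{c^{+}_{\bar{\mathcal{V}}}}{\Vert c^{+}_{\bar{\mathcal{V}}}\Vert}\qquad\text{and}\qquad a_{\mathcal{V}}=\frac{N-V}{\vert\partial^{+}\mathcal{V}\vert}\,c^{+}_{\bar{\mathcal{V}}}.$$ Similarly, if $a^{+}_{\mathcal{V}}$ is an altitude of $\mathcal{S}^{+}$ from the face $\mathcal{F}^{+}_{\mathcal{V}}$ to the complementary face $\mathcal{F}^{+}_{\bar{\mathcal{V}}}$, then $$a^{+}_{\mathcal{V}}=\frac{N-V}{\vert\partial\mathcal{V}\vert}\,c_{\bar{\mathcal{V}}}\qquad\text{and}\qquad \Vert a^{+}_{\mathcal{V}}\Vert^2=\frac{1}{\vert\partial\mathcal{V}\vert}.$$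
   Context: The graph $G$ has node set $\mathcal{N}=\{1,\dots,N\}$, link set $\mathcal{L}$ (links join distinct nodes) and weights $w_{ij}=w_{ji}>0$ for $(i,j)\in\mathcal{L}$ (all equal to $1$ in the unweighted case). The Laplacian $Q$ is the $N\times N$ symmetric matrix with $(Q)_{ii}=d_i$, the sum of the weights of links incident to $i$, $(Q)_{ij}=-w_{ij}$ if $(i,j)\in\mathcal{L}$, and $(Q)_{ij}=0$ otherwise. Since $G$ is connected, $Q$ has eigenvalues $\mu_1\ge\dots\ge\mu_{N-1}>\mu_N=0$ with orthonormal eigenvectors $z_1,\dots,z_{N}$, $z_N=u/\sqrt N$, $u$ the all-one vector; $Q^{\dagger}=\sum_{k=1}^{N-1}\frac1{\mu_k}z_kz_k^T$ is the pseudoinverse. Fix such an eigenbasis. The original simplex $\mathcal{S}$ of $G$ is the convex hull of the vertices $s_1,\dots,s_N\in\mathbb{R}^{N-1}$ with $(s_i)_k=(z_k)_i\sqrt{\mu_k}$ (so $s_i^Ts_j=(Q)_{ij}$), and the inverse simplex $\mathcal{S}^{+}$ is the convex hull of the vertices $s^{+}_1,\dots,s^{+}_N$ with $(s^{+}_i)_k=(z_k)_i/\sqrt{\mu_k}$ (so $s_i^{+T}s^{+}_j=(Q^{\dagger})_{ij}$). For $\emptyset\ne\mathcal{V}\subsetneq\mathcal{N}$ with $V$ elements, $\bar{\mathcal{V}}=\mathcal{N}\setminus\mathcal{V}$ and the face $\mathcal{F}_{\mathcal{V}}$ (resp. $\mathcal{F}^{+}_{\mathcal{V}}$) is the convex hull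 of $\{s_i\}_{i\in\mathcal{V}}$ (resp. $\{s^{+}_i\}_{i\in\mathcal{V}}$). Its centroid vector is $c_{\mathcal{V}}=\frac1V\sum_{i\in\mathcal{V}}s_i$ (resp. $c^{+}_{\mathcal{V}}=\frac1V\sum_{i\in\mathcal{V}}s^{+}_i$). An altitude $a_{\mathcal{V}}$ of $\mathcal{S}$ is a vector $a_{\mathcal{V}}=p^{\star}-q^{\star}$ with $p^{\star}\in\mathcal{F}_{\bar{\mathcal{V}}}$ and $q^{\star}\in\mathcal{F}_{\mathcal{V}}$ which is orthogonal to both faces, i.e. orthogonal to $p-p'$ for all $p,p'\in\mathcal{F}_{\mathcal{V}}$ and for all $p,p'\in\mathcal{F}_{\bar{\mathcal{V}}}$; an altitude $a^{+}_{\mathcal{V}}$ of $\mathcal{S}^{+}$ is defined in the same way with $\mathcal{F}^{+}_{\mathcal{V}},\mathcal{F}^{+}_{\bar{\mathcal{V}}}$. The cut size $\vert\partial\mathcal{V}\vert$ is the total weight (number, in the unweighted case) of links with one endpoint in $\mathcal{V}$ and the other in $\bar{\mathcal{V}}$; $\vert\partial^{+}\mathcal{V}\vert:=u_{\mathcal{V}}^TQ^{\dagger}u_{\mathcal{V}}$, where $u_{\mathcal{V}}\in\{0,1\}^N$ is the indicator vector of $\mathcal{V}$. -}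

module Defs where

open import Level using (Level; _⊔_; 0ℓ) renaming (suc to lsuc)
open import Algebra.Core using (Op₁)
open import Algebra.Bundles using (CommutativeRing)
open import Algebra.Apartness.Bundles using (HeytingField)
import Algebra.Definitions.RawMonoid
import Algebra.Properties.Ring
import Algebra.Properties.Semiring.Sum
open import Data.Bool.Base using (if_then_else_)
open import Data.Fin.Base using (Fin; fromℕ; inject₁) renaming (_≤_ to _≤ᶠ_)
open import Data.Fin.Properties using (_≟_)
open import Data.Fin.Subset using (Subset; _∈_; _⊂_; Nonempty; ⊤; ∁; ∣_∣)
open import Data.Fin.Subset.Properties using (x∉p⇒x∈∁p; x∈p⇒∣p-x∣<∣p∣)
open import Data.Nat.Base as ℕ using (ℕ; zero; suc; z≤n; s≤s)
import Data.Nat.Properties as ℕ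
open import Data.Product.Base using (Σ-syntax; ∃-syntax; _×_; _,_; proj₁)
open import Data.Sum.Base using (_⊎_)
open import Data.Vec.Base using (lookup)
open import Data.Vec.Functional using (Vector)
import Data.Vec.Functional.Relation.Binary.Equality.Setoid as VecEq
open import Relation.Binary.Core using (Rel)
open import Relation.Binary.Definitions using (Decidable)
open import Relation.Binary.PropositionalEquality using (_≢_)
open import Relation.Binary.Structures using (IsStrictPartialOrder)
open import Relation.Binary.Construct.Closure.ReflexiveTransitive using (Star)
open import Relation.Nullary.Decidable using (⌊_⌋)
open import Relation.Nullary.Negation using (¬_)

-- The real numbers, axiomatised as a Cauchy complete Archimedean ordered field.
-- The order is treated constructively (apartness, no trichotomy), so that both
-- the classical reals and Bishop's reals are models.

record RealNumbers (c ℓ₁ ℓ₂ : Level) : Set (lsuc (c ⊔ ℓ₁ ⊔ ℓ₂)) where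
  field
    heytingField : HeytingField c ℓ₁ ℓ₂

  open HeytingField heytingField public

  commutativeRing : CommutativeRing c ℓ₁
  commutativeRing = record { isCommutativeRing = isCommutativeRing }

  open CommutativeRing commutativeRing public
    using (ring; semiring; +-rawMonoid)

  infix 4 _<_ _≤_
  field
    _<_                  : Rel Carrier ℓ₂
    isStrictPartialOrder : IsStrictPartialOrder _≈_ _<_
    <⇒#                  : ∀ {x y} → x < y → x # y
    #⇒<⊎>                : ∀ {x y} → x # y → x < y ⊎ y < x
    0<1                  : 0# < 1#
    +-monoˡ-<            : ∀ {x y} z → x < y → x + z < y + z
    *-pos                : ∀ {x y} → 0# < x → 0# < y → 0# < x * y

  _≤_ : Rel Carrier ℓ₂
  x ≤ y = ¬ (y < x)

  open Algebra.Definitions.RawMonoid +-rawMonoid public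
    using () renaming (_×_ to _×ℕ_)

  -- |x| < 1/(k+1)
  Within : ℕ → Carrier → Set ℓ₂
  Within k x = (suc k ×ℕ x < 1#) × (suc k ×ℕ (- x) < 1#)

  IsCauchy : (ℕ → Carrier) → Set ℓ₂
  IsCauchy f = ∀ k → ∃[ M ] (∀ m n → M ℕ.≤ m → M ℕ.≤ n → Within k (f m - f n))

  _ConvergesTo_ : (ℕ → Carrier) → Carrier → Set ℓ₂
  f ConvergesTo x = ∀ k → ∃[ M ] (∀ m → M ℕ.≤ m → Within k (f m - x))

  infix 9 √_
  field
    archimedean : ∀ x → ∃[ n ] (x < n ×ℕ 1#)
    complete    : ∀ f → IsCauchy f → ∃[ x ] (f ConvergesTo x)

    -- Total for notational convenience; only √ x with 0 ≤ x is meaningful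
    -- (a model may take √ (max x 0)).
    √_          : Op₁ Carrier
    √-cong      : ∀ {x y} → x ≈ y → √ x ≈ √ y
    √-nonneg    : ∀ x → 0# ≤ √ x
    √-square    : ∀ {x} → 0# ≤ x → √ x * √ x ≈ x

module SimplexGeometry {c ℓ₁ ℓ₂ : Level} (R : RealNumbers c ℓ₁ ℓ₂) where

  open RealNumbers R public
  open Algebra.Properties.Semiring.Sum semiring public using (sum)
  open Algebra.Properties.Ring ring using (-0#≈0#)
  open VecEq setoid public using (_≋_)

  private
    module < = IsStrictPartialOrder isStrictPartialOrder

    x-0≈x : ∀ x → x - 0# ≈ x
    x-0≈x x = trans (+-congˡ -0#≈0#) (+-identityʳ x)

  0<⇒#0 : ∀ {x} → 0# < x → x # 0#
  0<⇒#0 p = #-sym (<⇒# p)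

  √#0 : ∀ {x} → 0# < x → √ x # 0#
  √#0 {x} 0<x with #⇒invertible (0<⇒#0 0<x)
  ... | y , y[x-0]≈1 , _ = invertible⇒# (r * y , left , trans (*-comm _ _) left)
    where
    r = √ x

    left : (r * y) * (r - 0#) ≈ 1#
    left =
      trans (*-congˡ (x-0≈x r))
      (trans (*-congʳ (*-comm r y))
      (trans (*-assoc y r r)
      (trans (*-congˡ (√-square (<.asym 0<x)))
      (trans (*-congˡ (sym (x-0≈x x)))
             y[x-0]≈1))))

  infix 8 _⁻¹[_]
  _⁻¹[_] : ∀ x → x # 0# → Carrier
  x ⁻¹[ x#0 ] = proj₁ (#⇒invertible x#0)

  infixl 7 _/_[_]
  _/_[_] : Carrier → ∀ y → y # 0# → Carrier
  x / y [ y#0 ] = x * y ⁻¹[ y#0 ]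

  ⟦_⟧ : ℕ → Carrier
  ⟦ n ⟧ = n ×ℕ 1#

  0<⟦suc⟧ : ∀ n → 0# < ⟦ suc n ⟧
  0<⟦suc⟧ zero    = <.<-respʳ-≈ (sym (+-identityʳ 1#)) 0<1
  0<⟦suc⟧ (suc n) =
    <.trans (0<⟦suc⟧ n)
      (<.<-respˡ-≈ (+-identityˡ _) (+-monoˡ-< ⟦ suc n ⟧ 0<1))

  0<⟦⟧ : ∀ {n} → 0 ℕ.< n → 0# < ⟦ n ⟧
  0<⟦⟧ {suc n} _ = 0<⟦suc⟧ n

  infixl 7 _·_
  _·_ : ∀ {m} → Vector Carrier m → Vector Carrier m → Carrier
  x · y = sum λ k → x k * y k

  infixl 6 _-ᵛ_
  _-ᵛ_ : ∀ {m} → Vector Carrier m → Vector Carrier m → Vector Carrier m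
  (x -ᵛ y) k = x k - y k

  infixr 7 _*ᵛ_
  _*ᵛ_ : ∀ {m} → Carrier → Vector Carrier m → Vector Carrier m
  (a *ᵛ x) k = a * x k

  ‖_‖ : ∀ {m} → Vector Carrier m → Carrier
  ‖ x ‖ = √ (x · x)

  infixl 10 sum∈-syntax
  sum∈-syntax : ∀ {N} → Subset N → Vector Carrier N → Carrier
  sum∈-syntax W f = sum λ i → if lookup W i then f i else 0#
  syntax sum∈-syntax W (λ i → e) = ∑[ i ∈ W ] e

  indicator : ∀ {N} → Subset N → Vector Carrier N
  indicator W i = if lookup W i then 1# else 0#

  Nonempty⇒0<∣∣ : ∀ {N} {W : Subset N} → Nonempty W → 0 ℕ.< ∣ W ∣
  Nonempty⇒0<∣∣ (_ , i∈W) = ℕ.≤-<-trans z≤n (x∈p⇒∣p-x∣<∣p∣ i∈W)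

  ⊂⊤⇒∁-nonempty : ∀ {N} {W : Subset N} → W ⊂ ⊤ → Nonempty (∁ W)
  ⊂⊤⇒∁-nonempty (_ , i , _ , i∉W) = i , x∉p⇒x∈∁p i∉W

  record Graph (N : ℕ) : Set (lsuc 0ℓ ⊔ c ⊔ ℓ₁ ⊔ ℓ₂) where
    infix 4 _~_ _~?_
    field
      _~_     : Rel (Fin N) 0ℓ
      _~?_    : Decidable _~_
      ~-sym   : ∀ {i j} → i ~ j → j ~ i
      ~-irr   : ∀ {i j} → i ~ j → i ≢ j
      -- The values of w off the link set are irrelevant.
      w       : Fin N → Fin N → Carrier
      w-sym   : ∀ {i j} → i ~ j → w i j ≈ w j i
      w-pos   : ∀ {i j} → i ~ j → 0# < w i j

    linkWeight : Fin N → Fin N → Carrier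
    linkWeight i j = if ⌊ i ~? j ⌋ then w i j else 0#

    degree : Fin N → Carrier
    degree i = sum λ j → linkWeight i j

    laplacian : Fin N → Fin N → Carrier
    laplacian i j =
      if ⌊ i ≟ j ⌋ then degree i else
      if ⌊ i ~? j ⌋ then - w i j else 0#

    Connected : Set
    Connected = ∀ i j → Star _~_ i j

    cut : Subset N → Carrier
    cut V = ∑[ i ∈ V ] (∑[ j ∈ ∁ V ] linkWeight i j)

  -- The nodes are Fin (suc n), so N = suc n.  The index  fromℕ n  is the last
  -- one, belonging to μ_N = 0; the indices  inject₁ k  (k : Fin n) are the
  -- first N - 1 ones.
  record LaplacianEigenbasis {n : ℕ} (G : Graph (suc n)) : Set (c ⊔ ℓ₁ ⊔ ℓ₂) where
    open Graph G
    field
      μ           : Fin (suc n) → Carrier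
      z           : Fin (suc n) → Vector Carrier (suc n)
      eigen       : ∀ k → (λ i → laplacian i · z k) ≋ μ k *ᵛ z k
      normal      : ∀ k → z k · z k ≈ 1#
      orthogonal  : ∀ {k l} → k ≢ l → z k · z l ≈ 0#
      μ-antitone  : ∀ {k l} → k ≤ᶠ l → μ l ≤ μ k
      μ-positive  : ∀ (k : Fin n) → 0# < μ (inject₁ k)
      μ-last      : μ (fromℕ n) ≈ 0#
      z-last      : ∀ i → z (fromℕ n) i ≈ 1# / √ ⟦ suc n ⟧ [ √#0 (0<⟦suc⟧ n) ]

    vertex : Fin (suc n) → Vector Carrier n
    vertex i k = z (inject₁ k) i * √ μ (inject₁ k)

    vertex⁺ : Fin (suc n) → Vector Carrier n
    vertex⁺ i k = z (inject₁ k) i / √ μ (inject₁ k) [ √#0 (μ-positive k) ]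

    pseudoinverse : Fin (suc n) → Fin (suc n) → Carrier
    pseudoinverse i j = sum λ k →
      1# / μ (inject₁ k) [ 0<⇒#0 (μ-positive k) ] * (z (inject₁ k) i * z (inject₁ k) j)

    cut⁺ : Subset (suc n) → Carrier
    cut⁺ V = indicator V · (λ i → pseudoinverse i · indicator V)

  module _ {N m : ℕ} (s : Fin N → Vector Carrier m) where

    -- The convex hull of { s i | i ∈ W }.  Only the values of the coefficients
    -- on W matter.
    Face : Subset N → Vector Carrier m → Set (c ⊔ ℓ₁ ⊔ ℓ₂)
    Face W p = Σ[ t ∈ Vector Carrier N ]
      (∀ i → i ∈ W → 0# ≤ t i) ×
      (∑[ i ∈ W ] t i ≈ 1#) ×
      (p ≋ λ k → ∑[ i ∈ W ] (t i * s i k))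

    centroid : (W : Subset N) → Nonempty W → Vector Carrier m
    centroid W ne =
      (1# / ⟦ ∣ W ∣ ⟧ [ 0<⇒#0 (0<⟦⟧ (Nonempty⇒0<∣∣ ne)) ]) *ᵛ λ k → ∑[ i ∈ W ] s i k

    OrthogonalTo : Subset N → Vector Carrier m → Set (c ⊔ ℓ₁ ⊔ ℓ₂)
    OrthogonalTo W a = ∀ p p′ → Face W p → Face W p′ → a · (p -ᵛ p′) ≈ 0#

    record IsAltitude (V : Subset N) (a : Vector Carrier m) : Set (c ⊔ ℓ₁ ⊔ ℓ₂) where
      field
        p⋆ q⋆ : Vector Carrier m
        p⋆∈   : Face (∁ V) p⋆
        q⋆∈   : Face V q⋆
        a≋    : a ≋ p⋆ -ᵛ q⋆
        orthV : OrthogonalTo V a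
        orth∁ : OrthogonalTo (∁ V) a

{-# OPTIONS --safe #-}

-- The vertices s, s⁺ of the two simplices are dual: sᵢ · s⁺ⱼ = δᵢⱼ - 1/N and
-- Σᵢ s⁺ᵢ sᵢᵀ = I, with Σᵢ sᵢ = Σᵢ s⁺ᵢ = 0.  Let w = Σ_{i ∉ V} s⁺ᵢ.  If a is an
-- altitude of the simplex on s, then i ↦ sᵢ · a is constant on V and on its
-- complement, so a = Σᵢ (sᵢ · a) s⁺ᵢ is a multiple g w of w.  As a is a difference
-- of points of the two faces, duality gives a · w = 1, whence g (w · w) = 1 and
-- a · a = g.  Since w = - Σ_{i ∈ V} s⁺ᵢ, the number w · w is the cut size formed
-- with the Gram matrix of s⁺.  Everything is symmetric in s and s⁺.

module Submission where

open import Defs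
open import Data.Nat.Base using (ℕ; zero; suc; _∸_) renaming (_≤_ to _≤ℕ_)
open import Data.Fin.Subset using (Subset; Nonempty; _∈_; _⊂_; ⊤; ∁; ∣_∣)
open import Data.Product.Base using (Σ-syntax; _×_; _,_; proj₁; proj₂)
open import Data.Vec.Functional using (Vector)

open import Algebra.Bundles using (CommutativeRing)
import Algebra.Apartness.Properties.HeytingCommutativeRing
import Algebra.Properties.Ring
import Algebra.Properties.Semiring.Sum
import Algebra.Solver.Ring.NaturalCoefficients.Default
open import Data.Bool.Base using (true; false; not; if_then_else_)
open import Data.Fin.Base using (Fin; zero; suc; fromℕ; inject₁)
open import Data.Fin.Properties using (_≟_; inject₁-injective; fromℕ≢inject₁)
open import Data.Fin.Subset.Properties using (∣∁p∣≡n∸∣p∣; x∈∁p⇒x∉p)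
open import Data.Sum.Base using (inj₁; inj₂)
open import Data.Vec.Base using (lookup)
open import Data.Vec.Properties using (lookup-map; lookup⇒[]=; []=⇒lookup)
open import Function.Base using (flip; _∘_)
open import Level using (_⊔_)
open import Relation.Binary.PropositionalEquality as ≡ using (_≡_)
import Relation.Binary.Reasoning.Setoid
open import Relation.Binary.Structures using (IsStrictPartialOrder)
open import Relation.Nullary.Decidable using (yes; no; does; dec-true)
open import Relation.Nullary.Negation using (contradiction; ¬_)

module _ {c ℓ₁ ℓ₂} (R : RealNumbers c ℓ₁ ℓ₂) where

  open SimplexGeometry R hiding (zero)
  open CommutativeRing commutativeRing using (commutativeSemiring)
  open Algebra.Apartness.Properties.HeytingCommutativeRing heytingCommutativeRing
    using (invertibleʳ⇒#; x-0≈x)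
  open Algebra.Properties.Ring ring
    using ( -‿distribˡ-*; -‿distribʳ-*; -‿involutive; +-cancelʳ; +-inverseˡ-unique
          ; xyx⁻¹≈y; x≈z//y; //-rightDividesˡ; x∙y⁻¹≈ε⇒x≈y; [y-z]x≈yx-zx )
  open Algebra.Properties.Semiring.Sum semiring
    using ( sum-cong-≋; ∑-distrib-+; ∑-comm; *-distribˡ-sum; *-distribʳ-sum
          ; sum-init-last; sum-replicate-zero )
  open Algebra.Solver.Ring.NaturalCoefficients.Default commutativeSemiring
    using (solve; _:=_; _:+_; _:*_)
  open Relation.Binary.Reasoning.Setoid setoid
  private module < = IsStrictPartialOrder isStrictPartialOrder

  -- Ordered field

  private variable
    x y : Carrier

  x*y≈1⇒x#0 : x * y ≈ 1# → x # 0#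
  x*y≈1⇒x#0 xy≈1 = invertibleʳ⇒# (_ , trans (*-congʳ (x-0≈x _)) xy≈1)

  x*y#0⇒x#0 : x * y # 0# → x # 0#
  x*y#0⇒x#0 {x} {y} p with #⇒invertible p
  ... | z , _ , [xy-0]z≈1 = x*y≈1⇒x#0 (begin
    x * (y * z)         ≈⟨ *-assoc x y z ⟨
    x * y * z           ≈⟨ *-congʳ (x-0≈x (x * y)) ⟨
    (x * y - 0#) * z    ≈⟨ [xy-0]z≈1 ⟩
    1#                  ∎)

  x⁻¹*x≈1 : (p : x # 0#) → x ⁻¹[ p ] * x ≈ 1#
  x⁻¹*x≈1 {x} p = trans (*-congˡ (sym (x-0≈x x))) (proj₁ (proj₂ (#⇒invertible p)))

  -- A reciprocal depends on its apartness proof, so reciprocals are identified through the equation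
  -- they satisfy.
  inverse-unique : ∀ {x y z} → y * x ≈ 1# → z * x ≈ 1# → y ≈ z
  inverse-unique {x} {y} {z} yx≈1 zx≈1 = begin
    y            ≈⟨ *-identityˡ y ⟨
    1# * y       ≈⟨ *-congʳ zx≈1 ⟨
    z * x * y    ≈⟨ solve 3 (λ x y z → z :* x :* y := z :* (y :* x)) refl x y z ⟩
    z * (y * x)  ≈⟨ *-congˡ yx≈1 ⟩
    z * 1#       ≈⟨ *-identityʳ z ⟩
    z            ∎

  ¬#⇒≈ : ¬ (x # y) → x ≈ y
  ¬#⇒≈ = proj₁ (tight _ _)

  <0⇒0<- : x < 0# → 0# < - x
  <0⇒0<- {x} p = <.<-respˡ-≈ (-‿inverseʳ x) (<.<-respʳ-≈ (+-identityˡ (- x)) (+-monoˡ-< (- x) p))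

  0<-⇒<0 : 0# < - x → x < 0#
  0<-⇒<0 {x} p = <.<-respˡ-≈ (+-identityˡ x) (<.<-respʳ-≈ (-‿inverseˡ x) (+-monoˡ-< x p))

  0≤∧#0⇒0< : 0# ≤ x → x # 0# → 0# < x
  0≤∧#0⇒0< 0≤x x#0 with #⇒<⊎> x#0
  ... | inj₁ x<0 = contradiction x<0 0≤x
  ... | inj₂ 0<x = 0<x

  -x*-y≈x*y : ∀ x y → - x * - y ≈ x * y
  -x*-y≈x*y x y = begin
    - x * - y    ≈⟨ -‿distribˡ-* x (- y) ⟨
    - (x * - y)  ≈⟨ -‿cong (-‿distribʳ-* x y) ⟨
    - - (x * y)  ≈⟨ -‿involutive (x * y) ⟩
    x * y        ∎

  x#0⇒0<x*x : x # 0# → 0# < x * x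
  x#0⇒0<x*x {x} x#0 with #⇒<⊎> x#0
  ... | inj₂ 0<x = *-pos 0<x 0<x
  ... | inj₁ x<0 = <.<-respʳ-≈ (-x*-y≈x*y x x) (*-pos (<0⇒0<- x<0) (<0⇒0<- x<0))

  -- The sign of `x` cannot be decided outright. But `x * x < 0#` makes `x * x`, hence `x`, apart
  -- from zero, and then the square is positive.
  0≤x*x : ∀ x → 0# ≤ x * x
  0≤x*x x x²<0 = <.asym x²<0 (x#0⇒0<x*x (x*y#0⇒x#0 (<⇒# x²<0)))

  x*x≈0⇒x≈0 : x * x ≈ 0# → x ≈ 0#
  x*x≈0⇒x≈0 x²≈0 = ¬#⇒≈ λ x#0 → <.irrefl (sym x²≈0) (x#0⇒0<x*x x#0)

  -- Apartness of the product from zero passes to both factors, so their signs can be decided;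
  -- `y < 0#` would make the product negative.
  0<x*y∧0≤x⇒0<y : 0# < x * y → 0# ≤ x → 0# < y
  0<x*y∧0≤x⇒0<y {x} {y} 0<xy 0≤x
    with #⇒<⊎> (x*y#0⇒x#0 (0<⇒#0 (<.<-respʳ-≈ (*-comm x y) 0<xy)))
  ... | inj₂ 0<y = 0<y
  ... | inj₁ y<0 = contradiction 0<xy (<.asym (0<-⇒<0 (<.<-respʳ-≈ (sym (-‿distribʳ-* x y))
                     (*-pos (0≤∧#0⇒0< 0≤x (x*y#0⇒x#0 (0<⇒#0 0<xy))) (<0⇒0<- y<0)))))

  -- `≤` is a negated `<`. If `x + y < 0#`, cotransitivity of apartness at `x` leaves two cases:
  -- `x # 0#`, so that `x` is positive and `y < x + y < 0#`, or `x + y # x`, which gives `y < 0#` or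
  -- `x < 0#`.
  +-nonneg : 0# ≤ x → 0# ≤ y → 0# ≤ x + y
  +-nonneg {x} {y} 0≤x 0≤y x+y<0 with #-cotrans (<⇒# x+y<0) x
  ... | inj₂ x#0 = 0≤y (<.trans
          (<.<-respˡ-≈ (+-identityˡ y) (+-monoˡ-< y (0≤∧#0⇒0< 0≤x x#0))) x+y<0)
  ... | inj₁ x+y#x with #⇒<⊎> x+y#x
  ...   | inj₁ x+y<x = 0≤y (<.<-respˡ-≈ (xyx⁻¹≈y x y) (<.<-respʳ-≈ (-‿inverseʳ x) (+-monoˡ-< (- x) x+y<x)))
  ...   | inj₂ x<x+y = 0≤x (<.trans x<x+y x+y<0)

  x+y≈0⇒x≈0 : 0# ≤ x → 0# ≤ y → x + y ≈ 0# → x ≈ 0#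
  x+y≈0⇒x≈0 {x} {y} 0≤x 0≤y x+y≈0 = ¬#⇒≈ λ x#0 → 0≤y (<.<-respʳ-≈ x+y≈0
    (<.<-respˡ-≈ (+-identityˡ y) (+-monoˡ-< y (0≤∧#0⇒0< 0≤x x#0))))

  -- The root `r` satisfies `(r - x) * (x + r) ≈ 0#`. Were `r` apart from `x`, it would equal `- x`
  -- and be negative, against `√-nonneg`; tightness concludes.
  √[x*x]≈x : 0# < x → √ (x * x) ≈ x
  √[x*x]≈x {x} 0<x = ¬#⇒≈ λ r#x → √-nonneg (x * x) (0<-⇒<0 (<.<-respʳ-≈ (x≈-r r#x) 0<x))
    where
    r = √ (x * x)

    [r-x][x+r]≈0 : (r - x) * (x + r) ≈ 0#
    [r-x][x+r]≈0 = begin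
      (r - x) * (x + r)              ≈⟨ [y-z]x≈yx-zx (x + r) r x ⟩
      r * (x + r) - x * (x + r)      ≈⟨ +-congʳ (distribˡ r x r) ⟩
      r * x + r * r - x * (x + r)    ≈⟨ +-congʳ (+-congˡ (√-square (0≤x*x x))) ⟩
      r * x + x * x - x * (x + r)
        ≈⟨ +-congʳ (solve 2 (λ r x → r :* x :+ x :* x := x :* (x :+ r)) refl r x) ⟩
      x * (x + r) - x * (x + r)      ≈⟨ -‿inverseʳ _ ⟩
      0#                             ∎

    x≈-r : r # x → x ≈ - r
    x≈-r r#x with #⇒invertible r#x
    ... | t , t[r-x]≈1 , _ = +-inverseˡ-unique x r (begin
      x + r                    ≈⟨ *-identityˡ _ ⟨
      1# * (x + r)             ≈⟨ *-congʳ t[r-x]≈1 ⟨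
      t * (r - x) * (x + r)    ≈⟨ *-assoc t _ _ ⟩
      t * ((r - x) * (x + r))  ≈⟨ *-congˡ [r-x][x+r]≈0 ⟩
      t * 0#                   ≈⟨ zeroʳ t ⟩
      0#                       ∎)

  sum-nonneg : ∀ {m} {f : Vector Carrier m} → (∀ i → 0# ≤ f i) → 0# ≤ sum f
  sum-nonneg {zero}  _   = <.irrefl refl
  sum-nonneg {suc m} 0≤f = +-nonneg (0≤f zero) (sum-nonneg (0≤f ∘ suc))

  sum≈0⇒≈0 : ∀ {m} {f : Vector Carrier m} → (∀ i → 0# ≤ f i) → sum f ≈ 0# → ∀ i → f i ≈ 0#
  sum≈0⇒≈0 0≤f ∑≈0 zero    = x+y≈0⇒x≈0 (0≤f zero) (sum-nonneg (0≤f ∘ suc)) ∑≈0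
  sum≈0⇒≈0 0≤f ∑≈0 (suc i) = sum≈0⇒≈0 (0≤f ∘ suc)
    (x+y≈0⇒x≈0 (sum-nonneg (0≤f ∘ suc)) (0≤f zero) (trans (+-comm _ _) ∑≈0)) i

  -- Dot products

  ·-cong : ∀ {m} {x x′ y y′ : Vector Carrier m} → x ≋ x′ → y ≋ y′ → x · y ≈ x′ · y′
  ·-cong x≋ y≋ = sum-cong-≋ λ k → *-cong (x≋ k) (y≋ k)

  ·-congˡ : ∀ {m} (x : Vector Carrier m) {y y′ : Vector Carrier m} → y ≋ y′ → x · y ≈ x · y′
  ·-congˡ x = ·-cong {x = x} λ _ → refl

  ·-congʳ : ∀ {m} (y : Vector Carrier m) {x x′ : Vector Carrier m} → x ≋ x′ → x · y ≈ x′ · y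
  ·-congʳ y x≋ = ·-cong {y = y} x≋ λ _ → refl

  ·-comm : ∀ {m} (x y : Vector Carrier m) → x · y ≈ y · x
  ·-comm x y = sum-cong-≋ λ k → *-comm (x k) (y k)

  ·-nonneg : ∀ {m} (x : Vector Carrier m) → 0# ≤ x · x
  ·-nonneg x = sum-nonneg λ k → 0≤x*x (x k)

  x·x≈0⇒x≋0 : ∀ {m} (x : Vector Carrier m) → x · x ≈ 0# → ∀ k → x k ≈ 0#
  x·x≈0⇒x≋0 x p k = x*x≈0⇒x≈0 (sum≈0⇒≈0 (λ l → 0≤x*x (x l)) p k)

  ·-distribʳ-+ : ∀ {m} (y u v : Vector Carrier m) → (λ k → u k + v k) · y ≈ u · y + v · y
  ·-distribʳ-+ y u v = trans (sum-cong-≋ λ k → distribʳ (y k) (u k) (v k))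
                            (∑-distrib-+ (λ k → u k * y k) (λ k → v k * y k))

  ·-distribˡ-+ : ∀ {m} (x u v : Vector Carrier m) → x · (λ k → u k + v k) ≈ x · u + x · v
  ·-distribˡ-+ x u v = trans (sum-cong-≋ λ k → distribˡ (x k) (u k) (v k))
                            (∑-distrib-+ (λ k → x k * u k) (λ k → x k * v k))

  *ᵛ-· : ∀ {m} a (x y : Vector Carrier m) → (a *ᵛ x) · y ≈ a * (x · y)
  *ᵛ-· a x y = trans (sum-cong-≋ λ k → *-assoc a (x k) (y k)) (sym (*-distribˡ-sum a λ k → x k * y k))

  -- Associativity of row times matrix times column, by exchanging the two sums. The matrix `v` is
  -- at times a transposed one, such as `flip s` or `flip z`.
  combination-· : ∀ {m p} (t : Vector Carrier p) (v : Fin p → Vector Carrier m) (y : Vector Carrier m) →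
                  (λ k → sum λ i → t i * v i k) · y ≈ t · (λ i → v i · y)
  combination-· t v y = begin
    (sum λ k → (sum λ i → t i * v i k) * y k)
      ≈⟨ (sum-cong-≋ λ k → *-distribʳ-sum (y k) λ i → t i * v i k) ⟩
    (sum λ k → sum λ i → t i * v i k * y k)     ≈⟨ ∑-comm (λ k i → t i * v i k * y k) ⟩
    (sum λ i → sum λ k → t i * v i k * y k)     ≈⟨ (sum-cong-≋ λ i → *ᵛ-· (t i) (v i) y) ⟩
    (sum λ i → t i * (v i · y))                 ∎

  -- With the subtrahend moved to the left, only addition has to be distributed.
  -ᵛ-· : ∀ {m} (x y z : Vector Carrier m) → (x -ᵛ y) · z + y · z ≈ x · z
  -ᵛ-· x y z = begin
    (x -ᵛ y) · z + y · z            ≈⟨ ·-distribʳ-+ z (x -ᵛ y) y ⟨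
    (λ k → x k - y k + y k) · z     ≈⟨ ·-cong (λ k → //-rightDividesˡ (y k) (x k)) (λ _ → refl) ⟩
    x · z                           ∎

  -- Since `‖ x ‖ ≈ g * ‖ v ‖`, the quotient of `g` by `‖ x ‖` is an inverse of `‖ v ‖`. The
  -- apartness proofs are part of the result because the reciprocals are formed from them.
  normalise : ∀ {m} {g} {x v : Vector Carrier m} → 0# < g → 0# < v · v → x ≋ g *ᵛ v →
              Σ[ ‖x‖#0 ∈ ‖ x ‖ # 0# ] Σ[ ‖v‖#0 ∈ ‖ v ‖ # 0# ]
                (1# / ‖ x ‖ [ ‖x‖#0 ]) *ᵛ x ≋ (1# / ‖ v ‖ [ ‖v‖#0 ]) *ᵛ v
  normalise {g = g} {x} {v} 0<g 0<vv x≋gv = ‖x‖#0 , ‖v‖#0 , λ k → begin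
    1# * a * x k         ≈⟨ *-congˡ (x≋gv k) ⟩
    1# * a * (g * v k)   ≈⟨ *-congʳ (*-identityˡ a) ⟩
    a * (g * v k)        ≈⟨ *-assoc a g (v k) ⟨
    a * g * v k          ≈⟨ *-congʳ (inverse-unique ag‖v‖≈1 (x⁻¹*x≈1 ‖v‖#0)) ⟩
    ‖ v ‖ ⁻¹[ ‖v‖#0 ] * v k      ≈⟨ *-congʳ (*-identityˡ _) ⟨
    1# * ‖ v ‖ ⁻¹[ ‖v‖#0 ] * v k ∎
    where
    ‖v‖#0 = √#0 0<vv

    0<‖v‖ : 0# < ‖ v ‖
    0<‖v‖ = 0≤∧#0⇒0< (√-nonneg _) ‖v‖#0

    x·x≈ : x · x ≈ g * ‖ v ‖ * (g * ‖ v ‖)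
    x·x≈ = begin
      x · x                        ≈⟨ ·-cong x≋gv x≋gv ⟩
      (g *ᵛ v) · (g *ᵛ v)          ≈⟨ *ᵛ-· g v (g *ᵛ v) ⟩
      g * (v · (g *ᵛ v))           ≈⟨ *-congˡ (·-comm v (g *ᵛ v)) ⟩
      g * ((g *ᵛ v) · v)           ≈⟨ *-congˡ (*ᵛ-· g v v) ⟩
      g * (g * (v · v))            ≈⟨ *-congˡ (*-congˡ (√-square (<.asym 0<vv))) ⟨
      g * (g * (‖ v ‖ * ‖ v ‖))
        ≈⟨ solve 2 (λ g r → g :* (g :* (r :* r)) := g :* r :* (g :* r)) refl g ‖ v ‖ ⟩
      g * ‖ v ‖ * (g * ‖ v ‖)      ∎

    ‖x‖≈g‖v‖ : ‖ x ‖ ≈ g * ‖ v ‖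
    ‖x‖≈g‖v‖ = trans (√-cong x·x≈) (√[x*x]≈x (*-pos 0<g 0<‖v‖))

    ‖x‖#0 : ‖ x ‖ # 0#
    ‖x‖#0 = 0<⇒#0 (<.<-respʳ-≈ (sym ‖x‖≈g‖v‖) (*-pos 0<g 0<‖v‖))

    a = ‖ x ‖ ⁻¹[ ‖x‖#0 ]

    ag‖v‖≈1 : a * g * ‖ v ‖ ≈ 1#
    ag‖v‖≈1 = begin
      a * g * ‖ v ‖    ≈⟨ *-assoc a g _ ⟩
      a * (g * ‖ v ‖)  ≈⟨ *-congˡ ‖x‖≈g‖v‖ ⟨
      a * ‖ x ‖        ≈⟨ x⁻¹*x≈1 ‖x‖#0 ⟩
      1#               ∎

  -- Kronecker delta and orthonormal bases

  δ : ∀ {m} → Fin m → Vector Carrier m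
  δ i j = if does (i ≟ j) then 1# else 0#

  δ-refl : ∀ {m} (i : Fin m) → δ i i ≡ 1#
  δ-refl i = ≡.cong (if_then 1# else 0#) (dec-true (i ≟ i) ≡.refl)

  δ-· : ∀ {m} (i : Fin m) (f : Vector Carrier m) → δ i · f ≈ f i
  δ-· {suc m} zero f = begin
    1# * f zero + (sum λ j → 0# * f (suc j))  ≈⟨ +-cong (*-identityˡ _) (sym (*-distribˡ-sum 0# (f ∘ suc))) ⟩
    f zero + 0# * sum (f ∘ suc)               ≈⟨ +-congˡ (zeroˡ _) ⟩
    f zero + 0#                               ≈⟨ +-identityʳ _ ⟩
    f zero                                    ∎
  δ-· {suc m} (suc i) f = begin
    -- The tail of `δ (suc i)` is `δ i` by computation.
    0# * f zero + δ i · (f ∘ suc)  ≈⟨ +-cong (zeroˡ _) (δ-· i (f ∘ suc)) ⟩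
    0# + f (suc i)                 ≈⟨ +-identityˡ _ ⟩
    f (suc i)                      ∎

  0≤δ : ∀ {m} (i j : Fin m) → 0# ≤ δ i j
  0≤δ i j with does (i ≟ j)
  ... | true  = <.asym 0<1
  ... | false = <.irrefl refl

  Orthonormal : ∀ {m p} → (Fin p → Vector Carrier m) → Set ℓ₁
  Orthonormal v = ∀ k l → v k · v l ≈ δ k l

  -- The matrix D = I - Zᵀ Z is a symmetric idempotent of trace m - m = 0, and its
  -- trace is the sum of the squares of its entries.
  transpose-orthonormal : ∀ {m} {v : Fin m → Vector Carrier m} → Orthonormal v → Orthonormal (flip v)
  transpose-orthonormal {m} {v} orth i j =
    sym (x∙y⁻¹≈ε⇒x≈y (δ i j) (M i j) (x·x≈0⇒x≋0 (D i) (D·D≈0 i) j))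
    where
    M D : Fin m → Vector Carrier m
    M i j = flip v i · flip v j
    D i = δ i -ᵛ M i

    M·v : ∀ i k → M i · v k ≈ v k i
    M·v i k = begin
      M i · v k                    ≈⟨ combination-· (flip v i) v (v k) ⟩
      flip v i · (λ l → v l · v k) ≈⟨ ·-congˡ (flip v i) (λ l → ·-comm (v l) (v k)) ⟩
      flip v i · (λ l → v k · v l) ≈⟨ ·-congˡ (flip v i) (λ l → orth k l) ⟩
      flip v i · δ k               ≈⟨ ·-comm (flip v i) (δ k) ⟩
      δ k · flip v i               ≈⟨ δ-· k (flip v i) ⟩
      v k i                        ∎

    M·M : ∀ i → M i · M i ≈ M i i
    M·M i = begin
      M i · M i                     ≈⟨ combination-· (flip v i) v (M i) ⟩
      flip v i · (λ k → v k · M i)  ≈⟨ ·-congˡ (flip v i) (λ k → trans (·-comm (v k) (M i)) (M·v i k)) ⟩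
      M i i                         ∎

    D·M : ∀ i → D i · M i ≈ 0#
    D·M i = +-cancelʳ (M i · M i) _ _ (begin
      D i · M i + M i · M i  ≈⟨ -ᵛ-· (δ i) (M i) (M i) ⟩
      δ i · M i              ≈⟨ δ-· i (M i) ⟩
      M i i                  ≈⟨ M·M i ⟨
      M i · M i              ≈⟨ +-identityˡ _ ⟨
      0# + M i · M i         ∎)

    D·D+M≈1 : ∀ i → D i · D i + M i i ≈ 1#
    D·D+M≈1 i = begin
      D i · D i + M i i              ≈⟨ +-congʳ (+-identityʳ _) ⟨
      D i · D i + 0# + M i i         ≈⟨ +-congʳ (+-congˡ (trans (·-comm (M i) (D i)) (D·M i))) ⟨
      D i · D i + M i · D i + M i i  ≈⟨ +-congʳ (-ᵛ-· (δ i) (M i) (D i)) ⟩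
      δ i · D i + M i i  ≈⟨ +-congʳ (δ-· i (D i)) ⟩
      D i i + M i i      ≈⟨ //-rightDividesˡ (M i i) (δ i i) ⟩
      δ i i              ≡⟨ δ-refl i ⟩
      1#                 ∎

    ∑D·D≈0 : (sum λ i → D i · D i) ≈ 0#
    -- Summing `v k · v k` over `k` and `M i i` over `i` both add up the squares of all entries of
    -- `v`; the first sum counts one per vector.
    ∑D·D≈0 = +-cancelʳ (sum λ i → M i i) _ _ (begin
      (sum λ i → D i · D i) + (sum λ i → M i i)  ≈⟨ ∑-distrib-+ (λ i → D i · D i) (λ i → M i i) ⟨
      (sum λ i → D i · D i + M i i)              ≈⟨ sum-cong-≋ D·D+M≈1 ⟩
      (sum λ (i : Fin m) → 1#)
        ≈⟨ (sum-cong-≋ λ k → trans (orth k k) (reflexive (δ-refl k))) ⟨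
      (sum λ k → v k · v k)                      ≈⟨ ∑-comm (λ k i → v k i * v k i) ⟩
      (sum λ i → M i i)                          ≈⟨ +-identityˡ _ ⟨
      0# + (sum λ i → M i i)                     ∎)

    D·D≈0 : ∀ i → D i · D i ≈ 0#
    D·D≈0 = sum≈0⇒≈0 (λ i → ·-nonneg (D i)) ∑D·D≈0

  -- Sums over subsets

  if-*ʳ : ∀ b x y → (if b then x * y else 0#) ≈ (if b then x else 0#) * y
  if-*ʳ true  x y = refl
  if-*ʳ false x y = sym (zeroˡ y)

  if-1 : ∀ b x → (if b then x else 0#) ≈ (if b then 1# else 0#) * x
  if-1 true  x = sym (*-identityˡ x)
  if-1 false x = sym (zeroˡ x)

  ∑∈≈indicator· : ∀ {m} (W : Subset m) (f : Vector Carrier m) → ∑[ i ∈ W ] f i ≈ indicator W · f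
  ∑∈≈indicator· W f = sum-cong-≋ λ i → if-1 (lookup W i) (f i)

  ∑∈δ : ∀ {m} (W : Subset m) {i} → i ∈ W → (f : Vector Carrier m) → ∑[ j ∈ W ] (δ i j * f j) ≈ f i
  ∑∈δ {m} W {i} i∈W f = begin
    (∑[ j ∈ W ] (δ i j * f j))
      ≈⟨ (sum-cong-≋ λ j → if-*ˡ (lookup W j) (δ i j) (f j)) ⟩
    δ i · (λ j → if lookup W j then f j else 0#)     ≈⟨ δ-· i _ ⟩
    (if lookup W i then f i else 0#)                 ≡⟨ ≡.cong (if_then f i else 0#) ([]=⇒lookup i∈W) ⟩
    f i                                              ∎
    where
    if-*ˡ : ∀ b x y → (if b then x * y else 0#) ≈ x * (if b then y else 0#)
    if-*ˡ true  x y = refl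
    if-*ˡ false x y = sym (zeroʳ x)

  indicator·≈0 : ∀ {m} (W : Subset m) {f : Vector Carrier m} → (∀ {i} → i ∈ W → f i ≈ 0#) →
                 indicator W · f ≈ 0#
  indicator·≈0 {m} W {f} f≈0 = trans (sum-cong-≋ onW) (sum-replicate-zero m)
    where
    onW : ∀ i → indicator W i * f i ≈ 0#
    onW i with lookup W i in eq
    ... | true  = trans (*-congˡ (f≈0 (lookup⇒[]= i W eq))) (zeroʳ _)
    ... | false = zeroˡ _

  -- The bilinear form of `M` at two indicator vectors. Products of vertex sums are block sums of a
  -- Gram matrix, `cut` is one of the link weights, and so is `cut⁺` of the pseudoinverse, up to
  -- commutativity.
  blockSum : ∀ {m p} → Subset m → Subset p → (Fin m → Fin p → Carrier) → Carrier
  blockSum A B M = indicator A · (λ i → indicator B · M i)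

  blockSum-cong : ∀ {m p} (A : Subset m) (B : Subset p) {M M′ : Fin m → Fin p → Carrier} →
                  (∀ i j → M i j ≈ M′ i j) → blockSum A B M ≈ blockSum A B M′
  blockSum-cong A B M≈M′ = ·-congˡ (indicator A) λ i →
                           ·-congˡ (indicator B) (M≈M′ i)

  blockSum-∑∈ : ∀ {m p} (A : Subset m) (B : Subset p) (M : Fin m → Fin p → Carrier) →
                ∑[ i ∈ A ] (∑[ j ∈ B ] M i j) ≈ blockSum A B M
  blockSum-∑∈ A B M = trans (∑∈≈indicator· A λ i → ∑[ j ∈ B ] M i j)
    (·-congˡ (indicator A) λ i → ∑∈≈indicator· B (M i))

  -- Cancellation is asked only on the block itself: the block of `V` and `∁ V` avoids the diagonal
  -- of the Laplacian.
  blockSum-+≈0 : ∀ {m p} (A : Subset m) (B : Subset p) {M M′ : Fin m → Fin p → Carrier} →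
                 (∀ {i j} → i ∈ A → j ∈ B → M i j + M′ i j ≈ 0#) → blockSum A B M + blockSum A B M′ ≈ 0#
  blockSum-+≈0 A B {M} {M′} M+M′≈0 = trans (sym (·-distribˡ-+ (indicator A) _ _))
    (indicator·≈0 A λ {i} i∈A → trans (sym (·-distribˡ-+ (indicator B) (M i) (M′ i)))
      (indicator·≈0 B λ j∈B → M+M′≈0 i∈A j∈B))

  -- Vertex sums and faces

  module _ {m N : ℕ} (s : Fin N → Vector Carrier m) where

    vertexSum : Subset N → Vector Carrier m
    vertexSum W k = ∑[ i ∈ W ] s i k

    vertexSum-· : ∀ W y → vertexSum W · y ≈ indicator W · (λ i → s i · y)
    vertexSum-· W y = trans (·-congʳ y (λ k → ∑∈≈indicator· W λ i → s i k))
                            (combination-· (indicator W) s y)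

    vertexSum-·-vertexSum : ∀ A B → vertexSum A · vertexSum B ≈
      blockSum A B λ i j → s j · s i
    vertexSum-·-vertexSum A B = trans (vertexSum-· A (vertexSum B)) (·-congˡ (indicator A)
      λ i → trans (·-comm (s i) (vertexSum B)) (vertexSum-· B (s i)))

    vertexSum-∁ : (∀ k → sum (λ i → s i k) ≈ 0#) → ∀ W k → vertexSum W k ≈ - vertexSum (∁ W) k
    vertexSum-∁ ∑s≈0 W k = +-inverseˡ-unique _ _ (begin
      vertexSum W k + vertexSum (∁ W) k
        ≈⟨ ∑-distrib-+ (λ i → if lookup W i then s i k else 0#)
                       (λ i → if lookup (∁ W) i then s i k else 0#) ⟨
      (sum λ i → (if lookup W i then s i k else 0#) + (if lookup (∁ W) i then s i k else 0#))
        ≈⟨ sum-cong-≋ split ⟩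
      (sum λ i → s i k)
        ≈⟨ ∑s≈0 k ⟩
      0#  ∎)
      where
      split : ∀ i → (if lookup W i then s i k else 0#) + (if lookup (∁ W) i then s i k else 0#) ≈ s i k
      split i rewrite lookup-map i not W with lookup W i
      ... | true  = +-identityʳ _
      ... | false = +-identityˡ _

    -- The convex coefficients are `δ i`. This lets orthogonality to a face be tested on differences
    -- of its vertices.
    vertex∈Face : ∀ {W i} → i ∈ W → Face s W (s i)
    vertex∈Face {W} {i} i∈W = δ i , (λ j _ → 0≤δ i j) , ∑≈1 , λ k → sym (∑∈δ W i∈W λ j → s j k)
      where
      ∑≈1 : ∑[ j ∈ W ] δ i j ≈ 1#
      ∑≈1 = trans (sum-cong-≋ λ j → if-cong (lookup W j) (sym (*-identityʳ _))) (∑∈δ W i∈W λ _ → 1#)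
        where
        if-cong : ∀ b {x y} → x ≈ y → (if b then x else 0#) ≈ (if b then y else 0#)
        if-cong true  p = p
        if-cong false p = refl

    -- A linear functional with value `α` at all vertices keeps it on the hull, since the
    -- coefficients add up to one.
    Face-level : ∀ {W p} {y : Vector Carrier m} {α} → (∀ i → i ∈ W → s i · y ≈ α) → Face s W p → p · y ≈ α
    Face-level {W} {p} {y} {α} level (t , _ , ∑t≈1 , p≋) = begin
      p · y
        ≈⟨ ·-congʳ y (λ k → trans (p≋ k) (sum-cong-≋ λ i → if-*ʳ (lookup W i) (t i) (s i k))) ⟩
      (λ k → sum λ i → tW i * s i k) · y             ≈⟨ combination-· tW s y ⟩
      (sum λ i → tW i * (s i · y))                   ≈⟨ sum-cong-≋ onW ⟩
      (sum λ i → tW i * α)                           ≈⟨ *-distribʳ-sum α tW ⟨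
      sum tW * α                                     ≈⟨ *-congʳ ∑t≈1 ⟩
      1# * α                                         ≈⟨ *-identityˡ α ⟩
      α                                              ∎
      where
      -- The coefficients are arbitrary off `W`; cutting them off to zero there turns sums over `W`
      -- into full sums.
      tW : Vector Carrier N
      tW i = if lookup W i then t i else 0#

      onW : ∀ i → tW i * (s i · y) ≈ tW i * α
      onW i with lookup W i in eq
      ... | true  = *-congˡ (level i (lookup⇒[]= i W eq))
      ... | false = trans (zeroˡ _) (sym (zeroˡ _))

  -- Dual vertex systems

  -- In matrix form, `gram` says that the product of `s` with the transpose of `s⁺` is the identity
  -- minus `ρ` times the all-one matrix, and `frame` that the product in the other order is the
  -- identity. For the simplices of a graph `ρ` is `q * q`, where `q` is the reciprocal of the root
  -- of `N`.
  record Dual {m N : ℕ} (s s⁺ : Fin N → Vector Carrier m) : Set (c ⊔ ℓ₁) where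
    field
      ρ        : Carrier
      gram     : ∀ i j → s i · s⁺ j + ρ ≈ δ i j
      balanced : ∀ k → sum (flip s⁺ k) ≈ 0#
      frame    : ∀ k l → flip s⁺ k · flip s l ≈ δ k l

  module _ {m N : ℕ} {s s⁺ : Fin N → Vector Carrier m} (dual : Dual s s⁺) (V : Subset N) where

    open Dual dual

    private
      w : Vector Carrier m
      w = vertexSum s⁺ (∁ V)

      1∁ : Vector Carrier N
      1∁ = indicator (∁ V)

      κ : Carrier
      κ = 1∁ · (λ _ → ρ)

    ∈∁⇒1 : ∀ {i} → i ∈ ∁ V → 1∁ i ≡ 1#
    ∈∁⇒1 i∈∁V = ≡.cong (if_then 1# else 0#) ([]=⇒lookup i∈∁V)

    ∈⇒0 : ∀ {i} → i ∈ V → 1∁ i ≡ 0#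
    ∈⇒0 {i} i∈V = ≡.cong (if_then 1# else 0#) (≡.trans (lookup-map i not V) (≡.cong not ([]=⇒lookup i∈V)))

    -- Sum `gram` over the complement of `V`. The functional given by `w` thus has level `0# - κ` on
    -- the vertices in `V` and `1# - κ` on the others, so `w` is normal to both faces.
    s·w+κ : ∀ i → s i · w + κ ≈ 1∁ i
    s·w+κ i = begin
      s i · w + κ
        ≈⟨ +-congʳ (trans (·-comm (s i) w) (vertexSum-· s⁺ (∁ V) (s i))) ⟩
      1∁ · (λ j → s⁺ j · s i) + κ
        ≈⟨ ∑-distrib-+ (λ j → 1∁ j * (s⁺ j · s i)) (λ j → 1∁ j * ρ) ⟨
      (sum λ j → 1∁ j * (s⁺ j · s i) + 1∁ j * ρ)
        ≈⟨ sum-cong-≋ gramʲ ⟩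
      δ i · 1∁
        ≈⟨ δ-· i 1∁ ⟩
      1∁ i ∎
      where
      gramʲ : ∀ j → 1∁ j * (s⁺ j · s i) + 1∁ j * ρ ≈ δ i j * 1∁ j
      gramʲ j = begin
        1∁ j * (s⁺ j · s i) + 1∁ j * ρ  ≈⟨ distribˡ (1∁ j) _ ρ ⟨
        1∁ j * (s⁺ j · s i + ρ)         ≈⟨ *-congˡ (+-congʳ (·-comm (s⁺ j) (s i))) ⟩
        1∁ j * (s i · s⁺ j + ρ)         ≈⟨ *-congˡ (gram i j) ⟩
        1∁ j * δ i j                    ≈⟨ *-comm _ _ ⟩
        δ i j * 1∁ j                    ∎

    -- Altitudes in a dual vertex system

    module _ {a : Vector Carrier m} (altitude : IsAltitude s V a) where

      open IsAltitude altitude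

      -- The feet `p⋆` and `q⋆` lie on two level sets of `w` that are one apart; `κ` cancels in the
      -- difference.
      altitude·w≈1 : a · w ≈ 1#
      altitude·w≈1 = +-cancelʳ (0# - κ) _ _ (begin
        a · w + (0# - κ)            ≈⟨ +-cong (·-cong a≋ (λ _ → refl)) (sym q·w) ⟩
        (p⋆ -ᵛ q⋆) · w + q⋆ · w     ≈⟨ -ᵛ-· p⋆ q⋆ w ⟩
        p⋆ · w                      ≈⟨ p·w ⟩
        1# - κ                      ≈⟨ +-congˡ (+-identityˡ (- κ)) ⟨
        1# + (0# - κ)               ∎)
        where
        p·w : p⋆ · w ≈ 1# - κ
        p·w = Face-level s (λ i i∈ → x≈z//y _ κ _ (trans (s·w+κ i) (reflexive (∈∁⇒1 i∈)))) p⋆∈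

        q·w : q⋆ · w ≈ 0# - κ
        q·w = Face-level s (λ i i∈ → x≈z//y _ κ _ (trans (s·w+κ i) (reflexive (∈⇒0 i∈)))) q⋆∈

      level : ∀ {W} → OrthogonalTo s W a → ∀ {i j} → i ∈ W → j ∈ W → s i · a ≈ s j · a
      level orth {i} {j} i∈ j∈ = begin
        s i · a                          ≈⟨ -ᵛ-· (s i) (s j) a ⟨
        (s i -ᵛ s j) · a + s j · a
          ≈⟨ +-congʳ (trans (·-comm (s i -ᵛ s j) a) (orth _ _ (vertex∈Face s i∈) (vertex∈Face s j∈))) ⟩
        0# + s j · a                     ≈⟨ +-identityˡ _ ⟩
        s j · a                          ∎

      -- Coordinate `l` of the expansion of `a` in the `s⁺ i` with coefficients `s i · a`, which is
      -- `frame` applied to `a`.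
      frame-expansion : ∀ l → (λ i → s i · a) · flip s⁺ l ≈ a l
      frame-expansion l = begin
        (λ i → s i · a) · flip s⁺ l             ≈⟨ ·-congʳ (flip s⁺ l) (λ i → ·-comm (s i) a) ⟩
        (λ i → a · s i) · flip s⁺ l             ≈⟨ combination-· a (flip s) (flip s⁺ l) ⟩
        a · (λ k → flip s k · flip s⁺ l)
          ≈⟨ ·-congˡ a (λ k → trans (·-comm (flip s k) (flip s⁺ l)) (frame l k)) ⟩
        a · δ l                                 ≈⟨ ·-comm a (δ l) ⟩
        δ l · a                                 ≈⟨ δ-· l a ⟩
        a l                                     ∎

      altitude-direction : Nonempty V → Nonempty (∁ V) → Σ[ g ∈ Carrier ] (a ≋ g *ᵛ w) × (g * (w · w) ≈ 1#)
      altitude-direction (i₀ , i₀∈V) (j₀ , j₀∈∁V) = g , a≋gw , gww≈1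
        where
        α = s i₀ · a
        -- The jump of the functional given by `a` from the vertices in `V` to the others.
        g = s j₀ · a - α

        s·a : ∀ i → s i · a ≈ α + g * 1∁ i
        s·a i with lookup V i in eq
        ... | true  = begin
          s i · a         ≈⟨ level orthV i∈V i₀∈V ⟩
          α               ≈⟨ +-identityʳ α ⟨
          α + 0#          ≈⟨ +-congˡ (zeroʳ g) ⟨
          α + g * 0#      ≡⟨ ≡.cong (λ x → α + g * x) (∈⇒0 i∈V) ⟨
          α + g * 1∁ i    ∎
          where
          i∈V : i ∈ V
          i∈V = lookup⇒[]= i V eq
        ... | false = begin
          s i · a         ≈⟨ level orth∁ i∈∁V j₀∈∁V ⟩
          s j₀ · a        ≈⟨ //-rightDividesˡ α (s j₀ · a) ⟨
          g + α           ≈⟨ +-comm g α ⟩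
          α + g           ≈⟨ +-congˡ (*-identityʳ g) ⟨
          α + g * 1#      ≡⟨ ≡.cong (λ x → α + g * x) (∈∁⇒1 i∈∁V) ⟨
          α + g * 1∁ i    ∎
          where
          i∈∁V : i ∈ ∁ V
          i∈∁V = lookup⇒[]= i (∁ V) (≡.trans (lookup-map i not V) (≡.cong not eq))

        a≋gw : a ≋ g *ᵛ w
        a≋gw l = begin
          a l                                       ≈⟨ frame-expansion l ⟨
          (λ i → s i · a) · u                       ≈⟨ ·-congʳ u s·a ⟩
          (λ i → α + g * 1∁ i) · u                  ≈⟨ ·-distribʳ-+ u (λ _ → α) (g *ᵛ 1∁) ⟩
          (λ _ → α) · u + (g *ᵛ 1∁) · u             ≈⟨ +-cong (sym (*-distribˡ-sum α u)) (*ᵛ-· g 1∁ u) ⟩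
          -- The `s⁺ i` sum to zero, so the common level `α` drops out.
          α * sum u + g * (1∁ · u)
            ≈⟨ +-cong (*-congˡ (balanced l)) (*-congˡ (sym (∑∈≈indicator· (∁ V) u))) ⟩
          α * 0# + g * w l                          ≈⟨ +-congʳ (zeroʳ α) ⟩
          0# + g * w l                              ≈⟨ +-identityˡ _ ⟩
          g * w l                                   ∎
          where u = flip s⁺ l

        gww≈1 : g * (w · w) ≈ 1#
        gww≈1 = trans (sym (*ᵛ-· g w w)) (trans (sym (·-congʳ w a≋gw)) altitude·w≈1)

    -- Brings in the mixed block of `V` and `∁ V`, the one that `cut` sums over.
    w·w+v·w≈0 : w · w + vertexSum s⁺ V · w ≈ 0#
    w·w+v·w≈0 = begin
      w · w + vertexSum s⁺ V · w                    ≈⟨ ·-distribʳ-+ w w (vertexSum s⁺ V) ⟨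
      (sum λ k → (w k + vertexSum s⁺ V k) * w k)    ≈⟨ (sum-cong-≋ λ k → *-congʳ (w+v≈0 k)) ⟩
      (sum λ k → 0# * w k)                          ≈⟨ *-distribˡ-sum 0# w ⟨
      0# * sum w                                    ≈⟨ zeroˡ _ ⟩
      0#                                            ∎
      where
      w+v≈0 : ∀ k → w k + vertexSum s⁺ V k ≈ 0#
      w+v≈0 k = trans (+-congˡ (vertexSum-∁ s⁺ balanced V k)) (-‿inverseʳ (w k))

    -- The sign from `vertexSum-∁` squares away. This brings in the block of `V` with itself, as in
    -- `cut⁺`.
    w·w≈v·v : w · w ≈ vertexSum s⁺ V · vertexSum s⁺ V
    w·w≈v·v = sum-cong-≋ λ k → trans (sym (-x*-y≈x*y (w k) (w k)))
      (sym (*-cong (vertexSum-∁ s⁺ balanced V k) (vertexSum-∁ s⁺ balanced V k)))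

  -- The simplices of a graph

  module _ {n : ℕ} {G : Graph (suc n)} (B : LaplacianEigenbasis G) where

    open Graph G
    open LaplacianEigenbasis B

    private
      N = suc n
      Z : Fin N → Vector Carrier n
      Z i k = z (inject₁ k) i
      q = 1# / √ ⟦ N ⟧ [ √#0 (0<⟦suc⟧ n) ]

    orthonormal : Orthonormal z
    orthonormal k l with k ≟ l
    ... | yes ≡.refl = normal k
    ... | no k≢l     = orthogonal k≢l

    completeness : ∀ i j → flip z i · flip z j ≈ δ i j
    completeness = transpose-orthonormal {v = z} orthonormal

    -- Dropping the last eigenvector, whose entries are all `q`, removes `q * q` from each product
    -- of rows.
    Z·Z : ∀ i j → Z i · Z j + q * q ≈ δ i j
    Z·Z i j = begin
      Z i · Z j + q * q                                  ≈⟨ +-congˡ (*-cong (z-last i) (z-last j)) ⟨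
      Z i · Z j + z (fromℕ n) i * z (fromℕ n) j          ≈⟨ sum-init-last (λ k → z k i * z k j) ⟨
      flip z i · flip z j                                ≈⟨ completeness i j ⟩
      δ i j                                              ∎

    sum-z≈0 : ∀ k → sum (z (inject₁ k)) ≈ 0#
    sum-z≈0 k = begin
      sum zₖ                        ≈⟨ *-identityʳ _ ⟨
      -- Inserting `q * √ ⟦ N ⟧` for one turns the sum into a product with the constant last
      -- eigenvector.
      sum zₖ * 1#                   ≈⟨ *-congˡ q√N≈1 ⟨
      sum zₖ * (q * √ ⟦ N ⟧)        ≈⟨ *-assoc _ q _ ⟨
      sum zₖ * q * √ ⟦ N ⟧          ≈⟨ *-congʳ (*-distribʳ-sum q zₖ) ⟩
      (sum λ i → zₖ i * q) * √ ⟦ N ⟧  ≈⟨ *-congʳ (sum-cong-≋ λ i → *-congˡ {zₖ i} (z-last i)) ⟨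
      zₖ · z (fromℕ n) * √ ⟦ N ⟧    ≈⟨ *-congʳ (orthogonal λ eq → fromℕ≢inject₁ (≡.sym eq)) ⟩
      0# * √ ⟦ N ⟧                  ≈⟨ zeroˡ _ ⟩
      0#                            ∎
      where
      zₖ = z (inject₁ k)
      q√N≈1 : q * √ ⟦ N ⟧ ≈ 1#
      q√N≈1 = trans (*-congʳ (*-identityˡ _)) (x⁻¹*x≈1 (√#0 (0<⟦suc⟧ n)))

    -- Both simplices scale the rows `Z i` coordinatewise, by `√ μ` and by its reciprocal. Keeping
    -- `d` and `e` general yields the duality in either order.
    scaled-dual : (d e : Vector Carrier n) → (∀ k → d k * e k ≈ 1#) →
                  Dual (λ i k → Z i k * d k) (λ i k → Z i k * e k)
    scaled-dual d e de≈1 = record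
      { ρ        = q * q
      ; gram     = λ i j → trans (+-congʳ (sum-cong-≋ λ k → cancel (Z i k) (Z j k) k)) (Z·Z i j)
      ; balanced = λ k → trans (sym (*-distribʳ-sum (e k) (z (inject₁ k))))
                               (trans (*-congʳ (sum-z≈0 k)) (zeroˡ (e k)))
      ; frame    = frame
      }
      where
      cancel : ∀ x y k → x * d k * (y * e k) ≈ x * y
      cancel x y k = begin
        x * d k * (y * e k)
          ≈⟨ solve 4 (λ x d y e → x :* d :* (y :* e) := x :* y :* (d :* e)) refl x (d k) y (e k) ⟩
        x * y * (d k * e k)  ≈⟨ *-congˡ (de≈1 k) ⟩
        x * y * 1#           ≈⟨ *-identityʳ _ ⟩
        x * y                ∎

      frame : ∀ k l → (λ i → Z i k * e k) · (λ i → Z i l * d l) ≈ δ k l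
      frame k l with k ≟ l
      ... | yes ≡.refl = trans
        (sum-cong-≋ λ i → trans (*-comm _ _) (cancel (Z i k) (Z i k) k))
        (normal (inject₁ k))
      ... | no k≢l = begin
        (sum λ i → Z i k * e k * (Z i l * d l))
          ≈⟨ (sum-cong-≋ λ i → solve 4 (λ x e y d → x :* e :* (y :* d) := e :* d :* (x :* y))
                                      refl (Z i k) (e k) (Z i l) (d l)) ⟩
        (sum λ i → e k * d l * (Z i k * Z i l))
          ≈⟨ *-distribˡ-sum (e k * d l) (λ i → Z i k * Z i l) ⟨
        e k * d l * (z (inject₁ k) · z (inject₁ l))
          ≈⟨ *-congˡ (orthogonal (k≢l ∘ inject₁-injective)) ⟩
        e k * d l * 0#
          ≈⟨ zeroʳ _ ⟩
        0# ∎

    dual-vertex : Dual vertex vertex⁺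
    dual-vertex = scaled-dual _ _ λ k → trans (*-comm _ _) (x⁻¹*x≈1 (√#0 (μ-positive k)))

    dual-vertex⁺ : Dual vertex⁺ vertex
    dual-vertex⁺ = scaled-dual _ _ λ k → x⁻¹*x≈1 (√#0 (μ-positive k))

    vertex⁺-gram : ∀ i j → vertex⁺ j · vertex⁺ i ≈ pseudoinverse i j
    vertex⁺-gram i j = sum-cong-≋ λ k → let e = √ μ (inject₁ k) ⁻¹[ √#0 (μ-positive k) ] in begin
      Z j k * e * (Z i k * e)
        ≈⟨ solve 3 (λ x y e → y :* e :* (x :* e) := e :* e :* (x :* y)) refl (Z i k) (Z j k) e ⟩
      e * e * (Z i k * Z j k)     ≈⟨ *-congʳ (inverse-unique (e*e*μ≈1 k) (x⁻¹*x≈1 (0<⇒#0 (μ-positive k)))) ⟩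
      μ (inject₁ k) ⁻¹[ 0<⇒#0 (μ-positive k) ] * (Z i k * Z j k)  ≈⟨ *-congʳ (*-identityˡ _) ⟨
      1# / μ (inject₁ k) [ 0<⇒#0 (μ-positive k) ] * (Z i k * Z j k)  ∎
      where
      e*e*μ≈1 : ∀ k → let e = √ μ (inject₁ k) ⁻¹[ √#0 (μ-positive k) ] in e * e * μ (inject₁ k) ≈ 1#
      e*e*μ≈1 k = let d = √ μ (inject₁ k); p = √#0 (μ-positive k); e = d ⁻¹[ p ] in begin
        e * e * μ (inject₁ k)  ≈⟨ *-congˡ (√-square (<.asym (μ-positive k))) ⟨
        e * e * (d * d)        ≈⟨ solve 2 (λ e d → e :* e :* (d :* d) := e :* d :* (e :* d)) refl e d ⟩
        e * d * (e * d)        ≈⟨ *-cong (x⁻¹*x≈1 p) (x⁻¹*x≈1 p) ⟩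
        1# * 1#                ≈⟨ *-identityˡ 1# ⟩
        1#                     ∎

    -- The spectral decomposition of the Laplacian: each `μ k *ᵛ z k` is traded for the Laplacian
    -- applied to `z k`, and `completeness` collapses the sum over `k`.
    vertex-gram : ∀ i j → vertex j · vertex i ≈ laplacian i j
    vertex-gram i j = begin
      vertex j · vertex i
        ≈⟨ (sum-cong-≋ λ k → trans
             (solve 3 (λ x y d → y :* d :* (x :* d) := d :* d :* x :* y)
                      refl (Z i k) (Z j k) (√ μ (inject₁ k)))
             (*-congʳ (*-congʳ (√-square (<.asym (μ-positive k)))))) ⟩
      (sum λ k → μ (inject₁ k) * Z i k * Z j k)
        ≈⟨ +-identityʳ _ ⟨
      -- The Gram sum stops before the last index; its term can be added because `μ (fromℕ n)` is
      -- zero.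
      (sum λ k → μ (inject₁ k) * Z i k * Z j k) + 0#
        ≈⟨ +-congˡ (trans (*-congʳ (trans (*-congʳ μ-last) (zeroˡ _))) (zeroˡ _)) ⟨
      (sum λ k → μ (inject₁ k) * Z i k * Z j k) + μ (fromℕ n) * z (fromℕ n) i * z (fromℕ n) j
        ≈⟨ sum-init-last (λ k → μ k * z k i * z k j) ⟨
      (sum λ k → μ k * z k i * z k j)
        ≈⟨ (sum-cong-≋ λ k → *-congʳ {z k j} (eigen k i)) ⟨
      (λ k → laplacian i · z k) · flip z j
        ≈⟨ combination-· (laplacian i) (flip z) (flip z j) ⟩
      laplacian i · (λ l → flip z l · flip z j)
        ≈⟨ ·-congˡ (laplacian i) (λ l → trans (·-comm (flip z l) (flip z j)) (completeness j l)) ⟩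
      laplacian i · δ j
        ≈⟨ ·-comm (laplacian i) (δ j) ⟩
      δ j · laplacian i
        ≈⟨ δ-· j (laplacian i) ⟩
      laplacian i j ∎

    -- Cut sizes as squared lengths of vertex sums

    module _ (V : Subset N) where

      private
        W⁺ W : Vector Carrier n
        W⁺ = vertexSum vertex⁺ (∁ V)
        W  = vertexSum vertex (∁ V)

      W⁺·W⁺≈cut⁺ : W⁺ · W⁺ ≈ cut⁺ V
      W⁺·W⁺≈cut⁺ = begin
        W⁺ · W⁺
          ≈⟨ w·w≈v·v dual-vertex V ⟩
        vertexSum vertex⁺ V · vertexSum vertex⁺ V
          ≈⟨ vertexSum-·-vertexSum vertex⁺ V V ⟩
        indicator V · (λ i → indicator V · (λ j → vertex⁺ j · vertex⁺ i))
          ≈⟨ ·-congˡ (indicator V) (λ i → trans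
               (·-comm (indicator V) (λ j → vertex⁺ j · vertex⁺ i))
               (·-congʳ (indicator V) (vertex⁺-gram i))) ⟩
        cut⁺ V ∎

      -- Membership on opposite sides excludes `i ≡ j`, so the entry is off the diagonal.
      linkWeight+laplacian : ∀ {i j} → i ∈ V → j ∈ ∁ V → linkWeight i j + laplacian i j ≈ 0#
      linkWeight+laplacian {i} {j} i∈V j∈∁V with i ≟ j
      ... | yes ≡.refl = contradiction i∈V (x∈∁p⇒x∉p j∈∁V)
      ... | no _ with i ~? j
      ...   | yes _ = -‿inverseʳ _
      ...   | no _  = +-identityˡ 0#

      cut+V·W≈0 : cut V + vertexSum vertex V · W ≈ 0#
      cut+V·W≈0 = trans
        (+-cong (blockSum-∑∈ V (∁ V) linkWeight)
                (trans (vertexSum-·-vertexSum vertex V (∁ V)) (blockSum-cong V (∁ V) vertex-gram)))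
        (blockSum-+≈0 V (∁ V) λ i∈V j∈∁V → linkWeight+laplacian i∈V j∈∁V)

      -- Both sides are the negative of `vertexSum vertex V · W`.
      W·W≈cut : W · W ≈ cut V
      W·W≈cut = +-cancelʳ (vertexSum vertex V · W) (W · W) (cut V)
        (trans (w·w+v·w≈0 dual-vertex⁺ V) (sym cut+V·W≈0))

  -- Altitudes and centroids

  module _ {m N : ℕ} {s : Fin N → Vector Carrier m} {V : Subset N} (ne : Nonempty (∁ V)) where

    private
      M = ⟦ ∣ ∁ V ∣ ⟧
      M#0 : M # 0#
      M#0 = 0<⇒#0 (0<⟦⟧ (Nonempty⇒0<∣∣ ne))
      w ctr : Vector Carrier m
      w = vertexSum s (∁ V)
      ctr = centroid s (∁ V) ne

    -- Makes the centroid a positive multiple of `w`, as `normalise` requires.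
    0<1/∣∁∣ : 0# < 1# / M [ M#0 ]
    0<1/∣∁∣ = 0<x*y∧0≤x⇒0<y
      (<.<-respʳ-≈ (sym (trans (*-congˡ (*-identityˡ _)) (trans (*-comm _ _) (x⁻¹*x≈1 M#0)))) 0<1)
      (<.asym (0<⟦⟧ (Nonempty⇒0<∣∣ ne)))

    -- The scale `g` is the reciprocal of `C`, and `w` is the centroid times the size of `∁ V`,
    -- which is `N ∸ ∣ V ∣`.
    multiple-of-centroid : ∀ {a : Vector Carrier m} {g C} → a ≋ g *ᵛ w → g * C ≈ 1# → (C#0 : C # 0#) →
                           a ≋ (⟦ N ∸ ∣ V ∣ ⟧ / C [ C#0 ]) *ᵛ ctr
    multiple-of-centroid {a} {g} {C} a≋gw gC≈1 C#0 k = begin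
      a k                                   ≈⟨ a≋gw k ⟩
      g * w k                               ≈⟨ *-congʳ (inverse-unique gC≈1 (x⁻¹*x≈1 C#0)) ⟩
      C⁻¹ * w k                             ≈⟨ *-identityˡ _ ⟨
      1# * (C⁻¹ * w k)                      ≈⟨ *-congʳ (x⁻¹*x≈1 M#0) ⟨
      M⁻¹ * M * (C⁻¹ * w k)
        ≈⟨ solve 4 (λ m′ m c w → m′ :* m :* (c :* w) := m :* c :* (m′ :* w)) refl M⁻¹ M C⁻¹ (w k) ⟩
      M * C⁻¹ * (M⁻¹ * w k)                 ≡⟨ ≡.cong (λ l → ⟦ l ⟧ * C⁻¹ * (M⁻¹ * w k)) (∣∁p∣≡n∸∣p∣ V) ⟩
      ⟦ N ∸ ∣ V ∣ ⟧ * C⁻¹ * (M⁻¹ * w k)     ≈⟨ *-congˡ (*-congʳ (*-identityˡ M⁻¹)) ⟨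
      ⟦ N ∸ ∣ V ∣ ⟧ * C⁻¹ * ctr k           ∎
      where
      C⁻¹ = C ⁻¹[ C#0 ]
      M⁻¹ = M ⁻¹[ M#0 ]

  module _ {m N : ℕ} {s s⁺ : Fin N → Vector Carrier m} (dual : Dual s s⁺)
           {V : Subset N} (neV : Nonempty V) (ne∁ : Nonempty (∁ V))
           {C : Carrier} (W·W≈C : vertexSum s⁺ (∁ V) · vertexSum s⁺ (∁ V) ≈ C)
           {a : Vector Carrier m} (altitude : IsAltitude s V a) where

    private
      w ctr : Vector Carrier m
      w = vertexSum s⁺ (∁ V)
      ctr = centroid s⁺ (∁ V) ne∁
      direction = altitude-direction dual V altitude neV ne∁
      g = proj₁ direction
      a≋gw = proj₁ (proj₂ direction)
      gww≈1 = proj₂ (proj₂ direction)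

      gC≈1 : g * C ≈ 1#
      gC≈1 = trans (*-congˡ (sym W·W≈C)) gww≈1

    -- The altitude itself supplies an inverse of `C`, namely `g`.
    C#0 : C # 0#
    C#0 = x*y≈1⇒x#0 (trans (*-comm C g) gC≈1)

    altitude≋multiple : a ≋ (⟦ N ∸ ∣ V ∣ ⟧ / C [ C#0 ]) *ᵛ ctr
    altitude≋multiple = multiple-of-centroid ne∁ a≋gw gC≈1 C#0

    -- As `a` is `g *ᵛ w` and `a · w` is one, `a · a` equals `g`, the inverse of `C`.
    altitude-norm² : ‖ a ‖ * ‖ a ‖ ≈ 1# / C [ C#0 ]
    altitude-norm² = begin
      ‖ a ‖ * ‖ a ‖     ≈⟨ √-square (·-nonneg a) ⟩
      a · a             ≈⟨ ·-congʳ a a≋gw ⟩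
      (g *ᵛ w) · a      ≈⟨ *ᵛ-· g w a ⟩
      g * (w · a)       ≈⟨ *-congˡ (trans (·-comm w a) (altitude·w≈1 dual V altitude)) ⟩
      g * 1#            ≈⟨ *-comm g 1# ⟩
      1# * g            ≈⟨ *-congˡ (inverse-unique gC≈1 (x⁻¹*x≈1 C#0)) ⟩
      1# / C [ C#0 ]    ∎

    -- Both `a` and the centroid are positive multiples of `w`; `g` is positive because
    -- `g * (w · w)` is one.
    altitude-parallel : Σ[ a≠0 ∈ ‖ a ‖ # 0# ] Σ[ ctr≠0 ∈ ‖ ctr ‖ # 0# ]
                          (1# / ‖ a ‖ [ a≠0 ]) *ᵛ a ≋ (1# / ‖ ctr ‖ [ ctr≠0 ]) *ᵛ ctr
    altitude-parallel = a≠0 , ctr≠0 , λ k → begin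
      1# / ‖ a ‖ [ a≠0 ] * a k        ≈⟨ proj₂ (proj₂ a-normalised) k ⟩
      -- Each use of `normalise` brings its own proof that `‖ w ‖` is apart from zero.
      1# / ‖ w ‖ [ w≠0 ] * w k        ≈⟨ *-congʳ (*-congˡ (inverse-unique (x⁻¹*x≈1 w≠0) (x⁻¹*x≈1 w≠0′))) ⟩
      1# / ‖ w ‖ [ w≠0′ ] * w k       ≈⟨ proj₂ (proj₂ ctr-normalised) k ⟨
      1# / ‖ ctr ‖ [ ctr≠0 ] * ctr k  ∎
      where
      0<ww : 0# < w · w
      0<ww = 0≤∧#0⇒0< (·-nonneg w) (x*y≈1⇒x#0 (trans (*-comm (w · w) g) gww≈1))

      0<g : 0# < g
      0<g = 0<x*y∧0≤x⇒0<y (<.<-respʳ-≈ (sym (trans (*-comm (w · w) g) gww≈1)) 0<1) (<.asym 0<ww)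

      a-normalised   = normalise {x = a} {v = w} 0<g 0<ww a≋gw
      ctr-normalised = normalise {x = ctr} {v = w} (0<1/∣∁∣ {s = s⁺} {V = V} ne∁) 0<ww (λ _ → refl)
      a≠0   = proj₁ a-normalised
      w≠0   = proj₁ (proj₂ a-normalised)
      ctr≠0 = proj₁ ctr-normalised
      w≠0′  = proj₁ (proj₂ ctr-normalised)

mainTheorem3 :
  ∀ {c ℓ₁ ℓ₂} (R : RealNumbers c ℓ₁ ℓ₂) → let open SimplexGeometry R in
  (n : ℕ) → let N = suc n in 2 ≤ℕ N →
  (G : Graph N) → let open Graph G in Connected →
  (B : LaplacianEigenbasis G) → let open LaplacianEigenbasis B in
  (V : Subset N) → Nonempty V → (V⊂ : V ⊂ ⊤) →
  let c̄  = centroid vertex (∁ V) (⊂⊤⇒∁-nonempty V⊂)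
      c̄⁺ = centroid vertex⁺ (∁ V) (⊂⊤⇒∁-nonempty V⊂)
  in
  (∀ (a : Vector Carrier n) → IsAltitude vertex V a →
    (Σ[ a≠0 ∈ ‖ a ‖ # 0# ] Σ[ c̄⁺≠0 ∈ ‖ c̄⁺ ‖ # 0# ]
      ((1# / ‖ a ‖ [ a≠0 ]) *ᵛ a ≋ (1# / ‖ c̄⁺ ‖ [ c̄⁺≠0 ]) *ᵛ c̄⁺)) ×
    (Σ[ ∂⁺≠0 ∈ cut⁺ V # 0# ]
      (a ≋ (⟦ N ∸ ∣ V ∣ ⟧ / cut⁺ V [ ∂⁺≠0 ]) *ᵛ c̄⁺)))
  ×
  (∀ (a⁺ : Vector Carrier n) → IsAltitude vertex⁺ V a⁺ →
    Σ[ ∂≠0 ∈ cut V # 0# ]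
      ((a⁺ ≋ (⟦ N ∸ ∣ V ∣ ⟧ / cut V [ ∂≠0 ]) *ᵛ c̄) ×
       (‖ a⁺ ‖ * ‖ a⁺ ‖ ≈ 1# / cut V [ ∂≠0 ])))
-- Altitudes of one simplex are governed by vertex sums of the other, hence the crossed pairing of
-- `dual-vertex` with `cut⁺` and of `dual-vertex⁺` with `cut`.
mainTheorem3 R n 2≤N G connected B V neV V⊂ =
    (λ a altitude → altitude-parallel R (dual-vertex R B) neV ne∁ (W⁺·W⁺≈cut⁺ R B V) altitude ,
                    C#0 R (dual-vertex R B) neV ne∁ (W⁺·W⁺≈cut⁺ R B V) altitude ,
                    altitude≋multiple R (dual-vertex R B) neV ne∁ (W⁺·W⁺≈cut⁺ R B V) altitude)
  , (λ a⁺ altitude → C#0 R (dual-vertex⁺ R B) neV ne∁ (W·W≈cut R B V) altitude ,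
                     altitude≋multiple R (dual-vertex⁺ R B) neV ne∁ (W·W≈cut R B V) altitude ,
                     altitude-norm² R (dual-vertex⁺ R B) neV ne∁ (W·W≈cut R B V) altitude)
  where ne∁ = SimplexGeometry.⊂⊤⇒∁-nonempty R V⊂
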